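{- $\mathcal A_3 = \mathcal A_5 = \mathcal A_7 = \mathcal A_8 = \mathcal A_{10}$.
   Context: An $\mathcal I$-zroupoid is an algebra $\langle A,\to,0\rangle$ ($\to$ binary, $0$ constant) satisfying $(x \to y) \to z \approx [(z' \to x) \to (y \to z)']'$ and $0''\approx 0$, where $x' := x \to 0$; $\mathcal I$ is the variety of $\mathcal I$-zroupoids. $\mathcal A_3, \mathcal A_5, \mathcal A_7, \mathcal A_8, \mathcal A_{10}$ are the subvarieties of $\mathcal I$ defined respectively by the identities (A3) $x \to (y \to z) \approx (x \to z) \to y$; (A5) $x \to (y \to z) \approx (y \to x) \to z$; (A7) $x \to (y \to z) \approx (y \to z) \to x$; (A8) $x \to (y \to z) \approx (z \to x) \to y$; (A10) $x \to (y \to z) \approx (z \to y) \to x$. -}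

module Defs where

open import Level using (Level; suc)
open import Relation.Binary.PropositionalEquality using (_≡_)

record Zroupoid (a : Level) : Set (suc a) where
  field
    Carrier : Set a
    _⇒_     : Carrier → Carrier → Carrier
    𝟘       : Carrier
  infixr 5 _⇒_

  _′ : Carrier → Carrier
  x ′ = x ⇒ 𝟘

IsIZroupoid : ∀ {a} → Zroupoid a → Set a
IsIZroupoid Z = (∀ x y z → (x ⇒ y) ⇒ z ≡ (((z ′) ⇒ x) ⇒ ((y ⇒ z) ′)) ′)
              × ((𝟘 ′) ′ ≡ 𝟘)
  where
    open Zroupoid Z
    open import Data.Product using (_×_)

module _ {a} (Z : Zroupoid a) where
  open Zroupoid Z

  A3 : Set a
  A3 = ∀ x y z → x ⇒ (y ⇒ z) ≡ (x ⇒ z) ⇒ y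

  A5 : Set a
  A5 = ∀ x y z → x ⇒ (y ⇒ z) ≡ (y ⇒ x) ⇒ z

  A7 : Set a
  A7 = ∀ x y z → x ⇒ (y ⇒ z) ≡ (y ⇒ z) ⇒ x

  A8 : Set a
  A8 = ∀ x y z → x ⇒ (y ⇒ z) ≡ (z ⇒ x) ⇒ y

  A10 : Set a
  A10 = ∀ x y z → x ⇒ (y ⇒ z) ≡ (z ⇒ y) ⇒ x

{-# OPTIONS --safe #-}
module Submission where

open import Defs
open import Level using (Level)
open import Data.Product using (_×_; _,_; proj₁; proj₂)
open import Function.Base using (_∘_)
open import Function.Bundles using (_⇔_; mk⇔)
open import Relation.Binary.PropositionalEquality
  using (_≡_; sym; trans; cong; cong₂; module ≡-Reasoning)

-- Each of the five identities gives 0 → 0′ ≈ 0, hence 0′ ≈ 0, and from there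
-- x″ ≈ x′. Every value of the right-hand side of the defining identity of ℐ is
-- of the form w′, so all products (x → y) → z are then fixed by ′.
-- If moreover (x → y)′ ≈ (y → x)′, comparing fixed products gives (A7).
-- Conversely (A7) makes (x → y) → z invariant under all permutations of
-- x, y, z, which yields the other four identities.

-- General consequences of the defining identity of ℐ, shared by the five cases.

module IZroupoid {a} (Z : Zroupoid a) (isIZroupoid : IsIZroupoid Z) where
  open Zroupoid Z
  open ≡-Reasoning

  I : ∀ x y z → (x ⇒ y) ⇒ z ≡ ((z ′ ⇒ x) ⇒ (y ⇒ z) ′) ′
  I = proj₁ isIZroupoid

  𝟘″≡𝟘 : 𝟘 ′ ′ ≡ 𝟘
  𝟘″≡𝟘 = proj₂ isIZroupoid

  -- Each of the five identities supplies the hypothesis at `x = y = z = 𝟘`, because `𝟘 ′ ′ ≡ 𝟘`. It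
  -- makes the instance of `I` at `𝟘 ′`, `𝟘`, `𝟘 ′` collapse.
  𝟘𝟘′≡𝟘⇒𝟘′≡𝟘 : 𝟘 ⇒ 𝟘 ′ ≡ 𝟘 → 𝟘 ′ ≡ 𝟘
  𝟘𝟘′≡𝟘⇒𝟘′≡𝟘 𝟘𝟘′≡𝟘 = sym (begin
    𝟘                                  ≡⟨ 𝟘𝟘′≡𝟘 ⟨
    𝟘 ⇒ 𝟘 ′                            ≡⟨ cong (_⇒ 𝟘 ′) 𝟘″≡𝟘 ⟨
    𝟘 ′ ′ ⇒ 𝟘 ′                        ≡⟨ I (𝟘 ′) 𝟘 (𝟘 ′) ⟩
    ((𝟘 ′ ′ ⇒ 𝟘 ′) ⇒ (𝟘 ⇒ 𝟘 ′) ′) ′    ≡⟨ cong₂ (λ u v → ((u ⇒ 𝟘 ′) ⇒ v ′) ′) 𝟘″≡𝟘 𝟘𝟘′≡𝟘 ⟩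
    ((𝟘 ⇒ 𝟘 ′) ⇒ 𝟘 ′) ′                ≡⟨ cong (λ u → (u ⇒ 𝟘 ′) ′) 𝟘𝟘′≡𝟘 ⟩
    (𝟘 ⇒ 𝟘 ′) ′                        ≡⟨ cong _′ 𝟘𝟘′≡𝟘 ⟩
    𝟘 ′                                ∎)

  module _ (𝟘′≡𝟘 : 𝟘 ′ ≡ 𝟘) where

    I-at-z≡𝟘 : ∀ x y → (x ⇒ y) ′ ≡ ((𝟘 ⇒ x) ⇒ y ′ ′) ′
    I-at-z≡𝟘 x y = trans (I x y 𝟘) (cong (λ u → ((u ⇒ x) ⇒ y ′ ′) ′) 𝟘′≡𝟘)

    I-at-x≡y≡𝟘 : ∀ z → 𝟘 ⇒ z ≡ (z ′ ′ ⇒ (𝟘 ⇒ z) ′) ′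
    I-at-x≡y≡𝟘 z = trans (cong (_⇒ z) (sym 𝟘′≡𝟘)) (I 𝟘 𝟘 z)

    I-at-x≡z≡𝟘 : ∀ y → (𝟘 ⇒ y) ′ ≡ (𝟘 ⇒ y ′ ′) ′
    I-at-x≡z≡𝟘 y = trans (I-at-z≡𝟘 𝟘 y) (cong (λ u → (u ⇒ y ′ ′) ′) 𝟘′≡𝟘)

  -- By `square`, the prime of an element depends only on its double prime. By `x″≡x‴`, the elements
  -- `x` and `x ′` have the same double prime, hence the same prime.
  𝟘x≡x′⇒x″≡x′ : (∀ x → 𝟘 ⇒ x ≡ x ′) → ∀ x → x ′ ′ ≡ x ′
  𝟘x≡x′⇒x″≡x′ 𝟘x≡x′ x = begin
    x ′ ′                      ≡⟨ square (x ′) ⟩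
    (x ′ ′ ′ ⇒ x ′ ′ ′) ′      ≡⟨ cong (λ u → (u ⇒ u) ′) (x″≡x‴ x) ⟨
    (x ′ ′ ⇒ x ′ ′) ′          ≡⟨ square x ⟨
    x ′                        ∎
    where
    𝟘′≡𝟘 : 𝟘 ′ ≡ 𝟘
    𝟘′≡𝟘 = 𝟘𝟘′≡𝟘⇒𝟘′≡𝟘 (trans (𝟘x≡x′ (𝟘 ′)) 𝟘″≡𝟘)

    square : ∀ z → z ′ ≡ (z ′ ′ ⇒ z ′ ′) ′
    square z = begin
      z ′                          ≡⟨ 𝟘x≡x′ z ⟨
      𝟘 ⇒ z                        ≡⟨ I-at-x≡y≡𝟘 𝟘′≡𝟘 z ⟩
      (z ′ ′ ⇒ (𝟘 ⇒ z) ′) ′        ≡⟨ cong (λ u → (z ′ ′ ⇒ u ′) ′) (𝟘x≡x′ z) ⟩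
      (z ′ ′ ⇒ z ′ ′) ′            ∎

    x″≡x‴ : ∀ x → x ′ ′ ≡ x ′ ′ ′
    x″≡x‴ x = begin
      x ′ ′                    ≡⟨ I-at-z≡𝟘 𝟘′≡𝟘 x 𝟘 ⟩
      ((𝟘 ⇒ x) ⇒ 𝟘 ′ ′) ′      ≡⟨ cong₂ (λ u v → (u ⇒ v) ′) (𝟘x≡x′ x) 𝟘″≡𝟘 ⟩
      x ′ ′ ′                  ∎

  module _ (x″≡x′ : ∀ x → x ′ ′ ≡ x ′) where

    [xy]z-fixed : ∀ x y z → ((x ⇒ y) ⇒ z) ′ ≡ (x ⇒ y) ⇒ z
    [xy]z-fixed x y z = begin
      ((x ⇒ y) ⇒ z) ′                    ≡⟨ cong _′ (I x y z) ⟩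
      ((z ′ ⇒ x) ⇒ (y ⇒ z) ′) ′ ′        ≡⟨ x″≡x′ _ ⟩
      ((z ′ ⇒ x) ⇒ (y ⇒ z) ′) ′          ≡⟨ I x y z ⟨
      (x ⇒ y) ⇒ z                        ∎

    commutes-under-′⇒A7 : (∀ x y z → (x ⇒ (y ⇒ z)) ′ ≡ x ⇒ (y ⇒ z)) →
                          (∀ x y → (x ⇒ y) ′ ≡ (y ⇒ x) ′) → A7 Z
    commutes-under-′⇒A7 x[yz]-fixed ′-comm x y z = begin
      x ⇒ (y ⇒ z)            ≡⟨ x[yz]-fixed x y z ⟨
      (x ⇒ (y ⇒ z)) ′        ≡⟨ ′-comm x (y ⇒ z) ⟩
      ((y ⇒ z) ⇒ x) ′        ≡⟨ [xy]z-fixed y z x ⟩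
      (y ⇒ z) ⇒ x            ∎

  -- (A7) and (A10) at `y = z = 𝟘` both give the centrality hypothesis.
  𝟘𝟘-central⇒𝟘x≡x′ : 𝟘 ′ ≡ 𝟘 → (∀ x → x ⇒ (𝟘 ⇒ 𝟘) ≡ (𝟘 ⇒ 𝟘) ⇒ x) → ∀ x → 𝟘 ⇒ x ≡ x ′
  𝟘𝟘-central⇒𝟘x≡x′ 𝟘′≡𝟘 comm x = begin
    𝟘 ⇒ x           ≡⟨ cong (_⇒ x) 𝟘′≡𝟘 ⟨
    𝟘 ′ ⇒ x         ≡⟨ comm x ⟨
    x ⇒ 𝟘 ′         ≡⟨ cong (x ⇒_) 𝟘′≡𝟘 ⟩
    x ′             ∎

  -- From (A3) to (A7).

  module FromA3 (A3-holds : A3 Z) where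

    𝟘′≡𝟘 : 𝟘 ′ ≡ 𝟘
    𝟘′≡𝟘 = 𝟘𝟘′≡𝟘⇒𝟘′≡𝟘 (trans (A3-holds 𝟘 𝟘 𝟘) 𝟘″≡𝟘)

    x″≡x′ : ∀ x → x ′ ′ ≡ x ′
    x″≡x′ x = trans (sym (A3-holds x 𝟘 𝟘)) (cong (x ⇒_) 𝟘′≡𝟘)

    fixed : ∀ x y z → ((x ⇒ y) ⇒ z) ′ ≡ (x ⇒ y) ⇒ z
    fixed = [xy]z-fixed x″≡x′

    𝟘x′≡𝟘x : ∀ x → 𝟘 ⇒ x ′ ≡ 𝟘 ⇒ x
    𝟘x′≡𝟘x x = trans (A3-holds 𝟘 x 𝟘) (cong (_⇒ x) 𝟘′≡𝟘)

    -- (A3) turns the outer prime into an inner `𝟘 ⇒`, which does not distinguish `y ′` from `y`.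
    -- This clears the inner primes of `I-at-z≡𝟘`.
    [xy′]′≡[xy]′ : ∀ x y → (x ⇒ y ′) ′ ≡ (x ⇒ y) ′
    [xy′]′≡[xy]′ x y = begin
      (x ⇒ y ′) ′        ≡⟨ A3-holds x 𝟘 (y ′) ⟨
      x ⇒ (𝟘 ⇒ y ′)      ≡⟨ cong (x ⇒_) (𝟘x′≡𝟘x y) ⟩
      x ⇒ (𝟘 ⇒ y)        ≡⟨ A3-holds x 𝟘 y ⟩
      (x ⇒ y) ′          ∎

    [xy]′≡[𝟘x]y : ∀ x y → (x ⇒ y) ′ ≡ (𝟘 ⇒ x) ⇒ y
    [xy]′≡[𝟘x]y x y = begin
      (x ⇒ y) ′                ≡⟨ I-at-z≡𝟘 𝟘′≡𝟘 x y ⟩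
      ((𝟘 ⇒ x) ⇒ y ′ ′) ′      ≡⟨ [xy′]′≡[xy]′ (𝟘 ⇒ x) (y ′) ⟩
      ((𝟘 ⇒ x) ⇒ y ′) ′        ≡⟨ [xy′]′≡[xy]′ (𝟘 ⇒ x) y ⟩
      ((𝟘 ⇒ x) ⇒ y) ′          ≡⟨ fixed 𝟘 x y ⟩
      (𝟘 ⇒ x) ⇒ y              ∎

    -- A prime can be inserted on a fixed product, and (A3) converts it into a second `𝟘 ⇒`. In
    -- `(𝟘 ⇒ y) ⇒ (𝟘 ⇒ x)` the prefix can then be taken off `y` and left on `x`.
    𝟘[xy]≡𝟘[yx] : ∀ x y → 𝟘 ⇒ (x ⇒ y) ≡ 𝟘 ⇒ (y ⇒ x)
    𝟘[xy]≡𝟘[yx] x y = begin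
      𝟘 ⇒ (x ⇒ y)              ≡⟨ A3-holds 𝟘 x y ⟩
      (𝟘 ⇒ y) ⇒ x              ≡⟨ fixed 𝟘 y x ⟨
      ((𝟘 ⇒ y) ⇒ x) ′          ≡⟨ A3-holds (𝟘 ⇒ y) 𝟘 x ⟨
      (𝟘 ⇒ y) ⇒ (𝟘 ⇒ x)        ≡⟨ A3-holds 𝟘 (𝟘 ⇒ x) y ⟨
      𝟘 ⇒ ((𝟘 ⇒ x) ⇒ y)        ≡⟨ cong (𝟘 ⇒_) (A3-holds 𝟘 y x) ⟨
      𝟘 ⇒ (𝟘 ⇒ (y ⇒ x))        ≡⟨ A3-holds 𝟘 𝟘 (y ⇒ x) ⟩
      (𝟘 ⇒ (y ⇒ x)) ′          ≡⟨ cong _′ (A3-holds 𝟘 y x) ⟩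
      ((𝟘 ⇒ x) ⇒ y) ′          ≡⟨ fixed 𝟘 x y ⟩
      (𝟘 ⇒ x) ⇒ y              ≡⟨ A3-holds 𝟘 y x ⟨
      𝟘 ⇒ (y ⇒ x)              ∎

    ′-comm : ∀ x y → (x ⇒ y) ′ ≡ (y ⇒ x) ′
    ′-comm x y = begin
      (x ⇒ y) ′          ≡⟨ [xy]′≡[𝟘x]y x y ⟩
      (𝟘 ⇒ x) ⇒ y        ≡⟨ A3-holds 𝟘 y x ⟨
      𝟘 ⇒ (y ⇒ x)        ≡⟨ 𝟘[xy]≡𝟘[yx] y x ⟩
      𝟘 ⇒ (x ⇒ y)        ≡⟨ A3-holds 𝟘 x y ⟩
      (𝟘 ⇒ y) ⇒ x        ≡⟨ [xy]′≡[𝟘x]y y x ⟨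
      (y ⇒ x) ′          ∎

    a7 : A7 Z
    a7 = commutes-under-′⇒A7 x″≡x′ x[yz]-fixed ′-comm
      where
      x[yz]-fixed : ∀ x y z → (x ⇒ (y ⇒ z)) ′ ≡ x ⇒ (y ⇒ z)
      x[yz]-fixed x y z rewrite A3-holds x y z = fixed x z y

  -- From (A5) to (A7).

  module FromA5 (A5-holds : A5 Z) where

    𝟘′≡𝟘 : 𝟘 ′ ≡ 𝟘
    𝟘′≡𝟘 = 𝟘𝟘′≡𝟘⇒𝟘′≡𝟘 (trans (A5-holds 𝟘 𝟘 𝟘) 𝟘″≡𝟘)

    [𝟘x]′≡x′ : ∀ x → (𝟘 ⇒ x) ′ ≡ x ′
    [𝟘x]′≡x′ x = trans (sym (A5-holds x 𝟘 𝟘)) (cong (x ⇒_) 𝟘′≡𝟘)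

    x‴≡x′ : ∀ x → x ′ ′ ′ ≡ x ′
    x‴≡x′ x = begin
      x ′ ′ ′            ≡⟨ [𝟘x]′≡x′ (x ′ ′) ⟨
      (𝟘 ⇒ x ′ ′) ′      ≡⟨ I-at-x≡z≡𝟘 𝟘′≡𝟘 x ⟨
      (𝟘 ⇒ x) ′          ≡⟨ [𝟘x]′≡x′ x ⟩
      x ′                ∎

    I-via-A5 : ∀ x y z → (x ⇒ y) ⇒ z ≡ ((y ⇒ z) ⇒ (z ′ ⇒ x)) ′ ′
    I-via-A5 x y z = trans (I x y z) (cong _′ (A5-holds (z ′ ⇒ x) (y ⇒ z) 𝟘))

    -- `I-via-A5` exhibits the product as a double prime, and triple primes collapse to single ones.
    [[xy]z]″≡[xy]z : ∀ x y z → ((x ⇒ y) ⇒ z) ′ ′ ≡ (x ⇒ y) ⇒ z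
    [[xy]z]″≡[xy]z x y z rewrite I-via-A5 x y z = cong _′ (x‴≡x′ _)

    [xy]z≡[yz][z′x] : ∀ x y z → (x ⇒ y) ⇒ z ≡ (y ⇒ z) ⇒ (z ′ ⇒ x)
    [xy]z≡[yz][z′x] x y z = trans (I-via-A5 x y z) ([[xy]z]″≡[xy]z y z (z ′ ⇒ x))

    𝟘x≡x″ : ∀ x → 𝟘 ⇒ x ≡ x ′ ′
    𝟘x≡x″ x = begin
      -- Writing `𝟘` as `𝟘 ⇒ 𝟘` gives the nested shape needed for `[[xy]z]″≡[xy]z`.
      𝟘 ⇒ x              ≡⟨ cong (_⇒ x) 𝟘′≡𝟘 ⟨
      𝟘 ′ ⇒ x            ≡⟨ [[xy]z]″≡[xy]z 𝟘 𝟘 x ⟨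
      (𝟘 ′ ⇒ x) ′ ′      ≡⟨ cong (λ u → (u ⇒ x) ′ ′) 𝟘′≡𝟘 ⟩
      (𝟘 ⇒ x) ′ ′        ≡⟨ cong _′ ([𝟘x]′≡x′ x) ⟩
      x ′ ′              ∎

    𝟘x≡[xx]′ : ∀ x → 𝟘 ⇒ x ≡ (x ⇒ x) ′
    𝟘x≡[xx]′ x = begin
      𝟘 ⇒ x                      ≡⟨ I-at-x≡y≡𝟘 𝟘′≡𝟘 x ⟩
      (x ′ ′ ⇒ (𝟘 ⇒ x) ′) ′      ≡⟨ cong (λ u → (x ′ ′ ⇒ u) ′) ([𝟘x]′≡x′ x) ⟩
      (x ′ ′ ⇒ x ′) ′            ≡⟨ cong _′ (A5-holds (x ′ ′) x 𝟘) ⟩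
      (x ⇒ x ′ ′) ′ ′            ≡⟨ cong (λ u → u ′ ′) (A5-holds x (x ′) 𝟘) ⟩
      (x ′ ⇒ x) ′ ′ ′            ≡⟨ x‴≡x′ (x ′ ⇒ x) ⟩
      (x ′ ⇒ x) ′                ≡⟨ cong _′ (A5-holds 𝟘 x x) ⟨
      (𝟘 ⇒ (x ⇒ x)) ′            ≡⟨ [𝟘x]′≡x′ (x ⇒ x) ⟩
      (x ⇒ x) ′                  ∎

    x′x≡x′ : ∀ x → x ′ ⇒ x ≡ x ′
    x′x≡x′ x = begin
      x ′ ⇒ x            ≡⟨ A5-holds 𝟘 x x ⟨
      𝟘 ⇒ (x ⇒ x)        ≡⟨ 𝟘x≡x″ (x ⇒ x) ⟩
      (x ⇒ x) ′ ′        ≡⟨ cong _′ (𝟘x≡[xx]′ x) ⟨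
      (𝟘 ⇒ x) ′          ≡⟨ [𝟘x]′≡x′ x ⟩
      x ′                ∎

    -- The link is `x ⇒ x ′`: (A5) makes it `(x ⇒ x) ′`, hence `𝟘 ⇒ x`, while `[xy]z≡[yz][z′x]` at
    -- `x`, `𝟘`, `x` reaches it from `x ′ ⇒ x`.
    𝟘x≡x′ : ∀ x → 𝟘 ⇒ x ≡ x ′
    𝟘x≡x′ x = sym (begin
      x ′                      ≡⟨ x′x≡x′ x ⟨
      x ′ ⇒ x                  ≡⟨ [xy]z≡[yz][z′x] x 𝟘 x ⟩
      (𝟘 ⇒ x) ⇒ (x ′ ⇒ x)      ≡⟨ cong ((𝟘 ⇒ x) ⇒_) (x′x≡x′ x) ⟩
      (𝟘 ⇒ x) ⇒ x ′            ≡⟨ A5-holds x 𝟘 (x ′) ⟨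
      x ⇒ (𝟘 ⇒ x ′)            ≡⟨ cong (x ⇒_) (trans (𝟘x≡x″ (x ′)) (x‴≡x′ x)) ⟩
      x ⇒ x ′                  ≡⟨ A5-holds x x 𝟘 ⟩
      (x ⇒ x) ′                ≡⟨ 𝟘x≡[xx]′ x ⟨
      𝟘 ⇒ x                    ∎)

    -- (A5) unfolds `x ′ ⇒ y` in two ways, reading `x ′` as `x ⇒ 𝟘` or as `𝟘 ⇒ x`.
    ′-comm : ∀ x y → (x ⇒ y) ′ ≡ (y ⇒ x) ′
    ′-comm x y = begin
      (x ⇒ y) ′          ≡⟨ 𝟘x≡x′ (x ⇒ y) ⟨
      𝟘 ⇒ (x ⇒ y)        ≡⟨ A5-holds 𝟘 x y ⟩
      x ′ ⇒ y            ≡⟨ cong (_⇒ y) (𝟘x≡x′ x) ⟨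
      (𝟘 ⇒ x) ⇒ y        ≡⟨ A5-holds x 𝟘 y ⟨
      x ⇒ (𝟘 ⇒ y)        ≡⟨ cong (x ⇒_) (𝟘x≡x′ y) ⟩
      x ⇒ y ′            ≡⟨ A5-holds x y 𝟘 ⟩
      (y ⇒ x) ′          ∎

    a7 : A7 Z
    a7 = commutes-under-′⇒A7 x″≡x′ x[yz]-fixed ′-comm
      where
      x″≡x′ : ∀ x → x ′ ′ ≡ x ′
      x″≡x′ = 𝟘x≡x′⇒x″≡x′ 𝟘x≡x′

      x[yz]-fixed : ∀ x y z → (x ⇒ (y ⇒ z)) ′ ≡ x ⇒ (y ⇒ z)
      x[yz]-fixed x y z rewrite A5-holds x y z = [xy]z-fixed x″≡x′ y x z

  -- From (A8) to (A7).

  module FromA8 (A8-holds : A8 Z) where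

    𝟘′≡𝟘 : 𝟘 ′ ≡ 𝟘
    𝟘′≡𝟘 = 𝟘𝟘′≡𝟘⇒𝟘′≡𝟘 (trans (A8-holds 𝟘 𝟘 𝟘) 𝟘″≡𝟘)

    [𝟘x]′≡x′ : ∀ x → (𝟘 ⇒ x) ′ ≡ x ′
    [𝟘x]′≡x′ x = trans (sym (A8-holds x 𝟘 𝟘)) (cong (x ⇒_) 𝟘′≡𝟘)

    𝟘x′≡𝟘x : ∀ x → 𝟘 ⇒ x ′ ≡ 𝟘 ⇒ x
    𝟘x′≡𝟘x x = trans (A8-holds 𝟘 x 𝟘) (cong (_⇒ x) 𝟘′≡𝟘)

    𝟘x≡x″ : ∀ x → 𝟘 ⇒ x ≡ x ′ ′
    𝟘x≡x″ x = begin
      𝟘 ⇒ x              ≡⟨ 𝟘x′≡𝟘x x ⟨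
      𝟘 ⇒ x ′            ≡⟨ 𝟘x′≡𝟘x (x ′) ⟨
      -- By (A8), `𝟘 ⇒ (𝟘 ⇒ w)` is `w ′ ′`; the threefold prefix is read once with its inner pair
      -- and once with its outer pair.
      𝟘 ⇒ x ′ ′          ≡⟨ cong (𝟘 ⇒_) (A8-holds 𝟘 𝟘 x) ⟨
      𝟘 ⇒ (𝟘 ⇒ (𝟘 ⇒ x))  ≡⟨ A8-holds 𝟘 𝟘 (𝟘 ⇒ x) ⟩
      (𝟘 ⇒ x) ′ ′        ≡⟨ cong _′ ([𝟘x]′≡x′ x) ⟩
      x ′ ′              ∎

    x″≡x′ : ∀ x → x ′ ′ ≡ x ′
    x″≡x′ x = begin
      x ′ ′              ≡⟨ 𝟘x≡x″ x ⟨
      𝟘 ⇒ x              ≡⟨ 𝟘x′≡𝟘x x ⟨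
      𝟘 ⇒ x ′            ≡⟨ 𝟘x≡x″ (x ′) ⟩
      x ′ ′ ′            ≡⟨ [𝟘x]′≡x′ (x ′ ′) ⟨
      (𝟘 ⇒ x ′ ′) ′      ≡⟨ I-at-x≡z≡𝟘 𝟘′≡𝟘 x ⟨
      (𝟘 ⇒ x) ′          ≡⟨ [𝟘x]′≡x′ x ⟩
      x ′                ∎

    𝟘x≡x′ : ∀ x → 𝟘 ⇒ x ≡ x ′
    𝟘x≡x′ x = trans (𝟘x≡x″ x) (x″≡x′ x)

    fixed : ∀ x y z → ((x ⇒ y) ⇒ z) ′ ≡ (x ⇒ y) ⇒ z
    fixed = [xy]z-fixed x″≡x′

    x[yz]-fixed : ∀ x y z → (x ⇒ (y ⇒ z)) ′ ≡ x ⇒ (y ⇒ z)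
    x[yz]-fixed x y z rewrite A8-holds x y z = fixed z x y

    xy′≡x′y : ∀ x y → x ⇒ y ′ ≡ x ′ ⇒ y
    xy′≡x′y x y = trans (A8-holds x y 𝟘) (cong (_⇒ y) (𝟘x≡x′ x))

    [xy]′≡yx′ : ∀ x y → (x ⇒ y) ′ ≡ y ⇒ x ′
    [xy]′≡yx′ x y = trans (sym (A8-holds y 𝟘 x)) (cong (y ⇒_) (𝟘x≡x′ x))

    [xy]′≡y′x : ∀ x y → (x ⇒ y) ′ ≡ y ′ ⇒ x
    [xy]′≡y′x x y = trans ([xy]′≡yx′ x y) (xy′≡x′y y x)

    -- A prime-free form of `I`: the inner primes are moved outwards until `x″≡x′` and `fixed`
    -- absorb them.
    [xy]z≡[yz][xz] : ∀ x y z → (x ⇒ y) ⇒ z ≡ (y ⇒ z) ⇒ (x ⇒ z)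
    [xy]z≡[yz][xz] x y z = begin
      (x ⇒ y) ⇒ z                      ≡⟨ I x y z ⟩
      ((z ′ ⇒ x) ⇒ (y ⇒ z) ′) ′        ≡⟨ cong (λ u → (u ⇒ (y ⇒ z) ′) ′) ([xy]′≡y′x x z) ⟨
      ((x ⇒ z) ′ ⇒ (y ⇒ z) ′) ′        ≡⟨ cong _′ (xy′≡x′y ((x ⇒ z) ′) (y ⇒ z)) ⟩
      ((x ⇒ z) ′ ′ ⇒ (y ⇒ z)) ′        ≡⟨ cong (λ u → (u ⇒ (y ⇒ z)) ′) (x″≡x′ (x ⇒ z)) ⟩
      ((x ⇒ z) ′ ⇒ (y ⇒ z)) ′          ≡⟨ cong _′ ([xy]′≡y′x (y ⇒ z) (x ⇒ z)) ⟨
      ((y ⇒ z) ⇒ (x ⇒ z)) ′ ′          ≡⟨ x″≡x′ _ ⟩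
      ((y ⇒ z) ⇒ (x ⇒ z)) ′            ≡⟨ fixed y z (x ⇒ z) ⟩
      (y ⇒ z) ⇒ (x ⇒ z)                ∎

    [xy]′≡x[yx] : ∀ x y → (x ⇒ y) ′ ≡ x ⇒ (y ⇒ x)
    [xy]′≡x[yx] x y = begin
      (x ⇒ y) ′                ≡⟨ [xy]′≡y′x x y ⟩
      y ′ ⇒ x                  ≡⟨ cong (_⇒ x) (𝟘x≡x′ y) ⟨
      (𝟘 ⇒ y) ⇒ x              ≡⟨ [xy]z≡[yz][xz] 𝟘 y x ⟩
      (y ⇒ x) ⇒ (𝟘 ⇒ x)        ≡⟨ A8-holds (y ⇒ x) 𝟘 x ⟩
      (x ⇒ (y ⇒ x)) ′          ≡⟨ x[yz]-fixed x y x ⟩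
      x ⇒ (y ⇒ x)              ∎

    -- The expansion duplicates `z`. (A8) collects both copies in `z ⇒ (y ⇒ z)`, where `[xy]′≡x[yx]`
    -- removes one, and the remaining factors come out in the new order.
    swap : ∀ x y z → (x ⇒ y) ⇒ z ≡ (y ⇒ x) ⇒ z
    swap x y z = begin
      (x ⇒ y) ⇒ z              ≡⟨ [xy]z≡[yz][xz] x y z ⟩
      (y ⇒ z) ⇒ (x ⇒ z)        ≡⟨ A8-holds (y ⇒ z) x z ⟩
      (z ⇒ (y ⇒ z)) ⇒ x        ≡⟨ cong (_⇒ x) ([xy]′≡x[yx] z y) ⟨
      (z ⇒ y) ′ ⇒ x            ≡⟨ [xy]′≡y′x x (z ⇒ y) ⟨
      (x ⇒ (z ⇒ y)) ′          ≡⟨ x[yz]-fixed x z y ⟩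
      x ⇒ (z ⇒ y)              ≡⟨ A8-holds x z y ⟩
      (y ⇒ x) ⇒ z              ∎

    a7 : A7 Z
    a7 = commutes-under-′⇒A7 x″≡x′ x[yz]-fixed (λ x y → swap x y 𝟘)

  -- From (A10) to (A7).

  module FromA10 (A10-holds : A10 Z) where

    𝟘′≡𝟘 : 𝟘 ′ ≡ 𝟘
    𝟘′≡𝟘 = 𝟘𝟘′≡𝟘⇒𝟘′≡𝟘 (trans (A10-holds 𝟘 𝟘 𝟘) 𝟘″≡𝟘)

    𝟘x≡x′ : ∀ x → 𝟘 ⇒ x ≡ x ′
    𝟘x≡x′ = 𝟘𝟘-central⇒𝟘x≡x′ 𝟘′≡𝟘 (λ x → A10-holds x 𝟘 𝟘)

    a7 : A7 Z
    a7 = commutes-under-′⇒A7 x″≡x′ x[yz]-fixed ′-comm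
      where
      x″≡x′ : ∀ x → x ′ ′ ≡ x ′
      x″≡x′ = 𝟘x≡x′⇒x″≡x′ 𝟘x≡x′

      x[yz]-fixed : ∀ x y z → (x ⇒ (y ⇒ z)) ′ ≡ x ⇒ (y ⇒ z)
      x[yz]-fixed x y z rewrite A10-holds x y z = [xy]z-fixed x″≡x′ z y x

      ′-comm : ∀ x y → (x ⇒ y) ′ ≡ (y ⇒ x) ′
      -- The prefix `𝟘 ⇒` is a prime by `𝟘x≡x′`; (A10) also makes it a prime, but reverses the inner
      -- product.
      ′-comm x y = trans (sym (𝟘x≡x′ (x ⇒ y))) (A10-holds 𝟘 x y)

  -- From (A7) to the other four identities.

  module FromA7 (A7-holds : A7 Z) where

    𝟘′≡𝟘 : 𝟘 ′ ≡ 𝟘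
    𝟘′≡𝟘 = 𝟘𝟘′≡𝟘⇒𝟘′≡𝟘 (trans (A7-holds 𝟘 𝟘 𝟘) 𝟘″≡𝟘)

    𝟘x≡x′ : ∀ x → 𝟘 ⇒ x ≡ x ′
    𝟘x≡x′ = 𝟘𝟘-central⇒𝟘x≡x′ 𝟘′≡𝟘 (λ x → A7-holds x 𝟘 𝟘)

    x″≡x′ : ∀ x → x ′ ′ ≡ x ′
    x″≡x′ = 𝟘x≡x′⇒x″≡x′ 𝟘x≡x′

    fixed : ∀ x y z → ((x ⇒ y) ⇒ z) ′ ≡ (x ⇒ y) ⇒ z
    fixed = [xy]z-fixed x″≡x′

    -- As priming is idempotent, the right-hand side does not change when `x` or `y` is primed; the
    -- next two lemmas rest on this.
    [xy]′≡[x′y′]′ : ∀ x y → (x ⇒ y) ′ ≡ (x ′ ⇒ y ′) ′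
    [xy]′≡[x′y′]′ x y = begin
      (x ⇒ y) ′                ≡⟨ I-at-z≡𝟘 𝟘′≡𝟘 x y ⟩
      ((𝟘 ⇒ x) ⇒ y ′ ′) ′      ≡⟨ cong₂ (λ u v → (u ⇒ v) ′) (𝟘x≡x′ x) (x″≡x′ y) ⟩
      (x ′ ⇒ y ′) ′            ∎

    [xy]′≡x′y : ∀ x y → (x ⇒ y) ′ ≡ x ′ ⇒ y
    [xy]′≡x′y x y = begin
      (x ⇒ y) ′            ≡⟨ [xy]′≡[x′y′]′ x y ⟩
      (x ′ ⇒ y ′) ′        ≡⟨ cong (λ u → (u ⇒ y ′) ′) (x″≡x′ x) ⟨
      (x ′ ′ ⇒ y ′) ′      ≡⟨ [xy]′≡[x′y′]′ (x ′) y ⟨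
      (x ′ ⇒ y) ′          ≡⟨ fixed x 𝟘 y ⟩
      x ′ ⇒ y              ∎

    [xy]′≡xy′ : ∀ x y → (x ⇒ y) ′ ≡ x ⇒ y ′
    [xy]′≡xy′ x y = begin
      (x ⇒ y) ′            ≡⟨ [xy]′≡[x′y′]′ x y ⟩
      (x ′ ⇒ y ′) ′        ≡⟨ cong (λ v → (x ′ ⇒ v) ′) (x″≡x′ y) ⟨
      (x ′ ⇒ y ′ ′) ′      ≡⟨ [xy]′≡[x′y′]′ x (y ′) ⟨
      -- (A7) moves the nested factor to the left, where `fixed` can drop the outer prime.
      (x ⇒ y ′) ′          ≡⟨ cong _′ (A7-holds x y 𝟘) ⟩
      (y ′ ⇒ x) ′          ≡⟨ fixed y 𝟘 x ⟩
      y ′ ⇒ x              ≡⟨ A7-holds x y 𝟘 ⟨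
      x ⇒ y ′              ∎

    ′-comm : ∀ x y → (x ⇒ y) ′ ≡ (y ⇒ x) ′
    ′-comm x y = begin
      (x ⇒ y) ′      ≡⟨ [xy]′≡xy′ x y ⟩
      x ⇒ y ′        ≡⟨ A7-holds x y 𝟘 ⟩
      y ′ ⇒ x        ≡⟨ [xy]′≡x′y y x ⟨
      (y ⇒ x) ′      ∎

    drop-′ : ∀ x y z → (x ⇒ y) ′ ⇒ z ≡ (x ⇒ y) ⇒ z
    drop-′ x y z = trans (sym ([xy]′≡x′y (x ⇒ y) z)) (fixed x y z)

    swap : ∀ x y z → (x ⇒ y) ⇒ z ≡ (y ⇒ x) ⇒ z
    swap x y z = begin
      (x ⇒ y) ⇒ z        ≡⟨ drop-′ x y z ⟨
      (x ⇒ y) ′ ⇒ z      ≡⟨ cong (_⇒ z) (′-comm x y) ⟩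
      (y ⇒ x) ′ ⇒ z      ≡⟨ drop-′ y x z ⟩
      (y ⇒ x) ⇒ z        ∎

    [xy]z≡[zx][yz] : ∀ x y z → (x ⇒ y) ⇒ z ≡ (z ⇒ x) ⇒ (y ⇒ z)
    [xy]z≡[zx][yz] x y z = begin
      (x ⇒ y) ⇒ z                      ≡⟨ I x y z ⟩
      ((z ′ ⇒ x) ⇒ (y ⇒ z) ′) ′        ≡⟨ cong _′ ([xy]′≡xy′ (z ′ ⇒ x) (y ⇒ z)) ⟨
      ((z ′ ⇒ x) ⇒ (y ⇒ z)) ′ ′        ≡⟨ cong _′ (fixed (z ′) x (y ⇒ z)) ⟩
      ((z ′ ⇒ x) ⇒ (y ⇒ z)) ′          ≡⟨ fixed (z ′) x (y ⇒ z) ⟩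
      (z ′ ⇒ x) ⇒ (y ⇒ z)              ≡⟨ cong (_⇒ (y ⇒ z)) ([xy]′≡x′y z x) ⟨
      (z ⇒ x) ′ ⇒ (y ⇒ z)              ≡⟨ drop-′ z x (y ⇒ z) ⟩
      (z ⇒ x) ⇒ (y ⇒ z)                ∎

    -- `[xy]z≡[zx][yz]` at `𝟘`, `x`, `y` produces `y ′ ⇒ (x ⇒ y)`, so a repeated factor is absorbed
    -- into a prime.
    [xy]y≡[xy]′ : ∀ x y → (x ⇒ y) ⇒ y ≡ (x ⇒ y) ′
    [xy]y≡[xy]′ x y = begin
      (x ⇒ y) ⇒ y          ≡⟨ fixed x y y ⟨
      ((x ⇒ y) ⇒ y) ′      ≡⟨ cong _′ (A7-holds y x y) ⟨
      (y ⇒ (x ⇒ y)) ′      ≡⟨ [xy]′≡x′y y (x ⇒ y) ⟩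
      y ′ ⇒ (x ⇒ y)        ≡⟨ [xy]z≡[zx][yz] 𝟘 x y ⟨
      (𝟘 ⇒ x) ⇒ y          ≡⟨ cong (_⇒ y) (𝟘x≡x′ x) ⟩
      x ′ ⇒ y              ≡⟨ [xy]′≡x′y x y ⟨
      (x ⇒ y) ′            ∎

    -- Expanding twice by `[xy]z≡[zx][yz]` duplicates first `z`, then `u`; `[xy]y≡[xy]′` absorbs
    -- both duplicates, so that only `u` and `y` remain.
    rotate : ∀ x y z → (x ⇒ y) ⇒ z ≡ (z ⇒ x) ⇒ y
    rotate x y z = begin
      (x ⇒ y) ⇒ z                      ≡⟨ [xy]z≡[zx][yz] x y z ⟩
      u ⇒ (y ⇒ z)                      ≡⟨ A7-holds u y z ⟩
      (y ⇒ z) ⇒ u                      ≡⟨ swap y z u ⟩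
      (z ⇒ y) ⇒ u                      ≡⟨ [xy]z≡[zx][yz] z y u ⟩
      (u ⇒ z) ⇒ (y ⇒ u)                ≡⟨ cong (_⇒ (y ⇒ u)) (swap z x z) ⟩
      ((x ⇒ z) ⇒ z) ⇒ (y ⇒ u)          ≡⟨ cong (_⇒ (y ⇒ u)) ([xy]y≡[xy]′ x z) ⟩
      (x ⇒ z) ′ ⇒ (y ⇒ u)              ≡⟨ drop-′ x z (y ⇒ u) ⟩
      (x ⇒ z) ⇒ (y ⇒ u)                ≡⟨ swap x z (y ⇒ u) ⟩
      u ⇒ (y ⇒ u)                      ≡⟨ A7-holds u y u ⟩
      (y ⇒ u) ⇒ u                      ≡⟨ [xy]y≡[xy]′ y u ⟩
      (y ⇒ u) ′                        ≡⟨ ′-comm y u ⟩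
      (u ⇒ y) ′                        ≡⟨ fixed z x y ⟩
      u ⇒ y                            ∎
      where u = z ⇒ x

    a3 : A3 Z
    a3 x y z = begin
      x ⇒ (y ⇒ z)      ≡⟨ A7-holds x y z ⟩
      (y ⇒ z) ⇒ x      ≡⟨ swap y z x ⟩
      (z ⇒ y) ⇒ x      ≡⟨ rotate z y x ⟩
      (x ⇒ z) ⇒ y      ∎

    a5 : A5 Z
    a5 x y z = begin
      x ⇒ (y ⇒ z)      ≡⟨ A7-holds x y z ⟩
      (y ⇒ z) ⇒ x      ≡⟨ rotate y z x ⟩
      (x ⇒ y) ⇒ z      ≡⟨ swap x y z ⟩
      (y ⇒ x) ⇒ z      ∎

    a8 : A8 Z
    a8 x y z = begin
      x ⇒ (y ⇒ z)      ≡⟨ A7-holds x y z ⟩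
      (y ⇒ z) ⇒ x      ≡⟨ rotate y z x ⟩
      (x ⇒ y) ⇒ z      ≡⟨ rotate x y z ⟩
      (z ⇒ x) ⇒ y      ∎

    a10 : A10 Z
    a10 x y z = trans (A7-holds x y z) (swap y z x)

-- (A7) serves as the hub, so eight implications suffice.
theorem3p12 : ∀ {a : Level} (Z : Zroupoid a) → IsIZroupoid Z →
    (A3 Z ⇔ A5 Z) × (A3 Z ⇔ A7 Z) × (A3 Z ⇔ A8 Z) × (A3 Z ⇔ A10 Z)
theorem3p12 Z isIZroupoid =
    mk⇔ (FromA7.a5 ∘ FromA3.a7) (FromA7.a3 ∘ FromA5.a7)
  , mk⇔ FromA3.a7 FromA7.a3
  , mk⇔ (FromA7.a8 ∘ FromA3.a7) (FromA7.a3 ∘ FromA8.a7)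
  , mk⇔ (FromA7.a10 ∘ FromA3.a7) (FromA7.a3 ∘ FromA10.a7)
  where open IZroupoid Z isIZroupoid
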